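{- Dekking's result yields that there exists an abelian $9$-power free morphism $h$ over the binary alphabet $\Sigma=\{a,b\}$ with a fixed point $\Omega_1''$ such that: (i) $aaaaa$ is not a factor of $\Omega_1''$ (there are at most $4$ consecutive $a$'s in $\Omega_1''$); (ii) $bb$ is not a factor of $\Omega_1''$ (there are no two consecutive $b$'s in $\Omega_1''$); (iii) $\Omega_1''$ is abelian $9$-power free.
   Context: $\Sigma^*$ is the free monoid of finite words over $\Sigma$, with empty word $\epsilon$. A morphism $h$ over $\Sigma$ is a monoid homomorphism $h:\Sigma^*\to\Sigma^*$, extended letter by letter to infinite words; a fixed point of $h$ is an infinite word $\Omega\in\Sigma^{\mathbb{N}}$ with $h(\Omega)=\Omega$. A factor is a contiguous finite subword. The Parikh vector $\psi(u)$ of a finite word $u$ records the number of occurrences of each letter in $u$. A word $u$ (finite or infinite) is abelian $k$-power free if whenever $u=xv_1\cdots v_ky$ with $v_1,\dots,v_k$ finite words satisfying $\psi(v_1)=\cdots=\psi(v_k)$, one has $v_1=\cdots=v_k=\epsilon$. A morphism $h$ is abelian $n$-power free if $h(u)$ is abelian $n$-power free for every abelian $n$-power free word $u$. "Dekking's result", named in the claim as the tool from which the existence is obtained, is the following known sufficient criterion. Let $n>1$, let $h:\Sigma^*\to\Sigma^*$ be a morphism, $G$ a finite abelian group (written additively) and $f:\Sigma^*\to G$ a monoid morphism. Write $\operatorname{Pref}(h)$ for the set of all prefixes (including $\epsilon$ and the full word) of the words $h(\sigma)$, $\sigma\in\Sigma$, and $h(\Sigma)=\{h(\sigma):\sigma\in\Sigma\}$.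 Suppose: (D1) the frequency matrix of $h$, whose rows are the vectors $\psi(h(\sigma))$ for $\sigma\in\Sigma$, is non-singular; (D2) $f(h(\sigma))=0$ for each $\sigma\in\Sigma$; (D3) the set $f(\operatorname{Pref}(h))$ contains no arithmetic progression of length $n+1$ with non-zero common difference; (D4) for any positive integer $r$, if $f(v_1)=\cdots=f(v_r)$ with $v_i\in\operatorname{Pref}(h)\setminus h(\Sigma)$ for all $i$, then either $v_1=\cdots=v_r$ or $v_1'=\cdots=v_r'$, where $v_iv_i'=h(\sigma_{j_i})$ for some $\sigma_{j_i}\in\Sigma$. Then $h$ is an abelian $n$-power free morphism. -}

module Defs where

open import Algebra.Morphism.Structures using (module MonoidMorphisms)
open import Data.Fin.Base using (Fin)
open import Data.List.Base
  using (List; []; _++_; length; filter; concat; tabulate; applyUpTo; ++-[]-rawMonoid)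
open import Data.Nat.Base using (ℕ)
open import Data.Product.Base using (∃; _×_)
open import Function.Bundles using (_⇔_)
open import Relation.Binary.Definitions using (DecidableEquality)
open import Relation.Binary.PropositionalEquality using (_≡_; refl; _≗_)
open import Relation.Nullary using (yes; no)

data Letter : Set where
  a b : Letter

_≟_ : DecidableEquality Letter
a ≟ a = yes refl
a ≟ b = no λ ()
b ≟ a = no λ ()
b ≟ b = yes refl

data Word : Set where
  fin : List Letter → Word
  inf : (ℕ → Letter) → Word

infix 4 _≼_

-- p ≼ w : the finite word p is a prefix of w, i.e. w = p y for some
-- (finite or infinite) word y.
_≼_ : List Letter → Word → Set
p ≼ fin u = ∃ λ y → p ++ y ≡ u
p ≼ inf Ω = applyUpTo Ω (length p) ≡ p

IsFactor : List Letter → Word → Set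
IsFactor u w = ∃ λ x → x ++ u ≼ w

-- Parikh vector.
ψ : List Letter → Letter → ℕ
ψ u σ = length (filter (σ ≟_) u)

-- The tail y of a decomposition u = x v₁ ⋯ vₖ y is absorbed by _≼_.
AbelianPowerFree : ℕ → Word → Set
AbelianPowerFree k u =
  (x : List Letter) (v : Fin k → List Letter) →
  x ++ concat (tabulate v) ≼ u →
  (∀ i j → ψ (v i) ≗ ψ (v j)) →
  ∀ i → v i ≡ []

IsMorphism : (List Letter → List Letter) → Set
IsMorphism = MonoidMorphisms.IsMonoidHomomorphism
  (++-[]-rawMonoid Letter) (++-[]-rawMonoid Letter)

-- IsImage h u w : w = h(u), for h a morphism extended letter by letter to
-- infinite words.  A word is determined by its finite prefixes, and those of
-- h(u) are the prefixes of the words h(q), q a finite prefix of u.  A relation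
-- is used because h(u) can be finite for infinite u, when h erases letters.
-- On a finite word u it says w = fin (h u).
IsImage : (List Letter → List Letter) → Word → Word → Set
IsImage h u w = ∀ p → p ≼ w ⇔ (∃ λ q → q ≼ u × p ≼ fin (h q))

IsFixedPoint : (List Letter → List Letter) → (ℕ → Letter) → Set
IsFixedPoint h Ω = IsImage h (inf Ω) (inf Ω)

AbelianPowerFreeMorphism : ℕ → (List Letter → List Letter) → Set
AbelianPowerFreeMorphism n h =
  IsMorphism h ×
  (∀ u w → IsImage h u w → AbelianPowerFree n u → AbelianPowerFree n w)

{-# OPTIONS --safe #-}

-- Give a and b the weights 1 and 7 modulo 11, so that h(a) = aabaa and
-- h(b) = aabababab have weight 0.  If v₁ ⋯ v₉ is an abelian 9-power in h(q), each
-- of the ten ends of the vᵢ cuts some image h(σ) after a proper prefix rᵢ, and the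
-- weights of the rᵢ form an arithmetic progression.  These weights avoid two classes
-- modulo 11, which forces the difference to be 0; as distinct proper prefixes have
-- distinct weights, all rᵢ are the same word.  Hence each vᵢ is abelian equivalent
-- to some h(wᵢ), with w₁ ⋯ w₉ a factor of q, and non-singularity of the frequency
-- matrix makes w₁ ⋯ w₉ an abelian 9-power.  So h preserves abelian 9-power freeness, and the limit of hᵏ(a) is a fixed
-- point inheriting it from the letter a.
module Submission where

open import Defs
open import Data.Fin.Base using (Fin; zero; suc; toℕ; inject₁)
import Data.Fin.Properties as Fin
open import Data.List.Base
  using (List; []; _∷_; _++_; length; filter; concat; tabulate; concatMap; map;
         applyUpTo; foldl)
open import Data.List.Membership.Propositional using (_∈_)
open import Data.List.Membership.Propositional.Properties using (∈-map⁺; ∈-++⁺ˡ; ∈-++⁺ʳ)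
open import Data.List.Properties
  using (≡-dec; ∷-injective; ∷-injectiveˡ; ∷-injectiveʳ; ++-assoc; ++-identityʳ;
         length-++; filter-++; concatMap-++; foldl-++)
open import Data.List.Relation.Unary.All using (All; all?; lookup)
open import Data.List.Relation.Unary.Any using (here; there)
open import Data.Nat.Base
  using (ℕ; zero; suc; _+_; _*_; _≤_; _<_; z≤n; s≤s; NonZero; _≤′_; ≤′-refl; ≤′-step)
open import Data.Nat.DivMod
  using (_%_; _/_; _mod_; m≡m%n+[m/n]*n; [m+kn]%n≡m%n; m%n<n)
open import Data.Nat.Properties as ℕ
  using (+-cancelʳ-≡; *-cancelˡ-≡; *-zeroʳ; +-identityʳ; ≤-total; m≤m+n)
open import Data.List.Membership.DecPropositional ℕ._≟_ using (_∈?_)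
open import Data.Nat.Tactic.RingSolver using (solve-∀)
open import Data.Product.Base using (Σ-syntax; ∃; ∃₂; _×_; _,_; proj₁; proj₂)
open import Data.Sum.Base using (_⊎_; inj₁; inj₂)
import Data.Vec.Functional as Vector
open import Function.Base using (_∘_)
open import Function.Bundles using (mk⇔; module Equivalence)
open import Relation.Binary.PropositionalEquality
  using (_≡_; _≢_; refl; sym; trans; cong; cong₂; subst; _≗_; module ≡-Reasoning)
open import Relation.Nullary using (¬_)
open import Relation.Nullary.Decidable using (_→-dec_; from-yes)

-- Prefixes of words

properPrefixes : {A : Set} → List A → List (List A)
properPrefixes []       = []
properPrefixes (x ∷ xs) = [] ∷ map (x ∷_) (properPrefixes xs)

∈-properPrefixes : {A : Set} (p : List A) {x : A} {s : List A} →
                   p ∈ properPrefixes (p ++ x ∷ s)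
∈-properPrefixes []      = here refl
∈-properPrefixes (y ∷ p) = there (∈-map⁺ (y ∷_) (∈-properPrefixes p))

-- A tie `p ≡ u` goes to the first alternative, so in the second a letter of `u` is left after `p`,
-- which makes `p` a proper prefix.
++-compare : {A : Set} (p u : List A) {y z : List A} → p ++ y ≡ u ++ z →
             (∃ λ p′ → p ≡ u ++ p′ × p′ ++ y ≡ z) ⊎
             (∃₂ λ x s → p ++ x ∷ s ≡ u × y ≡ x ∷ s ++ z)
++-compare p       []      eq = inj₁ (p , refl , eq)
++-compare []      (x ∷ u) eq = inj₂ (x , u , refl , eq)
++-compare (x ∷ p) (_ ∷ u) eq with ∷-injective eq
... | refl , eq′ with ++-compare p u eq′
...   | inj₁ (p′ , refl , e)     = inj₁ (p′ , refl , e)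
...   | inj₂ (c , s , refl , e) = inj₂ (c , s , refl , e)

applyUpTo-prefix : {A : Set} (f : ℕ → A) (p y : List A) →
                   applyUpTo f (length (p ++ y)) ≡ p ++ y → applyUpTo f (length p) ≡ p
applyUpTo-prefix f []      y eq = refl
applyUpTo-prefix f (x ∷ p) y eq =
  cong₂ _∷_ (∷-injectiveˡ eq) (applyUpTo-prefix (f ∘ suc) p y (∷-injectiveʳ eq))

≼-prefix : ∀ w p y → p ++ y ≼ w → p ≼ w
≼-prefix (fin u) p y (z , eq) = y ++ z , trans (sym (++-assoc p y z)) eq
≼-prefix (inf Ω) p y eq       = applyUpTo-prefix Ω p y eq

≼-trans : ∀ w {p q} → p ≼ fin q → q ≼ w → p ≼ w
≼-trans w {p} (y , refl) q≼w = ≼-prefix w p y q≼w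

≼-inf-comparable : ∀ Ω p q → p ≼ inf Ω → q ≼ inf Ω → length p ≤ length q → p ≼ fin q
≼-inf-comparable Ω []      q       _  _  _         = q , refl
≼-inf-comparable Ω (x ∷ p) (y ∷ q) ep eq (s≤s p≤q) =
  let z , e = ≼-inf-comparable (Ω ∘ suc) p q (∷-injectiveʳ ep) (∷-injectiveʳ eq) p≤q
  in  z , cong₂ _∷_ (trans (sym (∷-injectiveˡ ep)) (∷-injectiveˡ eq)) e

powerFree-prefix : ∀ {k w q} → q ≼ w → AbelianPowerFree k w → AbelianPowerFree k (fin q)
powerFree-prefix {w = w} q≼w free x v p≼q = free x v (≼-trans w p≼q q≼w)

-- Parikh vectors

ψ-++ : ∀ u v σ → ψ (u ++ v) σ ≡ ψ u σ + ψ v σ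
ψ-++ u v σ = trans (cong length (filter-++ (σ ≟_) u v)) (length-++ (filter (σ ≟_) u))

ψ≗ψ[]⇒≡[] : ∀ u → ψ u ≗ ψ [] → u ≡ []
ψ≗ψ[]⇒≡[] []      _  = refl
ψ≗ψ[]⇒≡[] (a ∷ u) eq with () ← eq a
ψ≗ψ[]⇒≡[] (b ∷ u) eq with () ← eq b

weight : List Letter → ℕ
weight u = ψ u a + 7 * ψ u b

weight-++ : ∀ u v → weight (u ++ v) ≡ weight u + weight v
weight-++ u v = trans (cong₂ (λ m n → m + 7 * n) (ψ-++ u v a) (ψ-++ u v b))
                      (rearrange (ψ u a) (ψ v a) (ψ u b) (ψ v b))
  where
  rearrange : ∀ i j k l → i + j + 7 * (k + l) ≡ i + 7 * k + (j + 7 * l)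
  rearrange = solve-∀

-- The morphism

image : Letter → List Letter
image a = a ∷ a ∷ b ∷ a ∷ a ∷ []
image b = a ∷ a ∷ b ∷ a ∷ b ∷ a ∷ b ∷ a ∷ b ∷ []

h : List Letter → List Letter
h = concatMap image

h-++ : ∀ u v → h (u ++ v) ≡ h u ++ h v
h-++ = concatMap-++ image

h-isMorphism : IsMorphism h
h-isMorphism = record
  { isMagmaHomomorphism = record
    { isRelHomomorphism = record { cong = cong h }
    ; homo              = h-++
    }
  ; ε-homo = refl
  }

ψ-h : ∀ u → ψ (h u) a ≡ 4 * ψ u a + 5 * ψ u b × ψ (h u) b ≡ ψ u a + 4 * ψ u b
ψ-h []      = refl , refl
ψ-h (a ∷ u) = let ea , eb = ψ-h u in
  trans (cong (4 +_) ea) (rearrange (ψ u a) (ψ u b)) , cong suc eb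
  where
  rearrange : ∀ m n → 4 + (4 * m + 5 * n) ≡ 4 * suc m + 5 * n
  rearrange = solve-∀
ψ-h (b ∷ u) = let ea , eb = ψ-h u in
  trans (cong (5 +_) ea) (rearrangeᵃ (ψ u a) (ψ u b)) ,
  trans (cong (4 +_) eb) (rearrangeᵇ (ψ u a) (ψ u b))
  where
  rearrangeᵃ : ∀ m n → 5 + (4 * m + 5 * n) ≡ 4 * m + 5 * suc n
  rearrangeᵃ = solve-∀
  rearrangeᵇ : ∀ m n → 4 + (m + 4 * n) ≡ m + 4 * suc n
  rearrangeᵇ = solve-∀

-- The two images weigh 4 + 7 = 11 and 5 + 7 * 4 = 33, hence the coefficients 1 and 3.
weight-h : ∀ u → weight (h u) ≡ (ψ u a + 3 * ψ u b) * 11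
weight-h u = trans (cong₂ (λ m n → m + 7 * n) (proj₁ (ψ-h u)) (proj₂ (ψ-h u)))
                   (rearrange (ψ u a) (ψ u b))
  where
  rearrange : ∀ m n → 4 * m + 5 * n + 7 * (m + 4 * n) ≡ (m + 3 * n) * 11
  rearrange = solve-∀

-- Cramer's rule with determinant 11, the negative terms moved across.
frequencyMatrix-injective : ∀ m n m′ n′ →
  4 * m + 5 * n ≡ 4 * m′ + 5 * n′ → m + 4 * n ≡ m′ + 4 * n′ → m ≡ m′ × n ≡ n′
frequencyMatrix-injective m n m′ n′ e₁ e₂ =
  *-cancelˡ-≡ m m′ 11 (+-cancelʳ-≡ (5 * (m + 4 * n)) _ _ (begin
    11 * m + 5 * (m + 4 * n)     ≡⟨ rowᵃ m n ⟨
    4 * (4 * m + 5 * n)          ≡⟨ cong (4 *_) e₁ ⟩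
    4 * (4 * m′ + 5 * n′)        ≡⟨ rowᵃ m′ n′ ⟩
    11 * m′ + 5 * (m′ + 4 * n′)  ≡⟨ cong (λ t → 11 * m′ + 5 * t) e₂ ⟨
    11 * m′ + 5 * (m + 4 * n)    ∎)) ,
  *-cancelˡ-≡ n n′ 11 (+-cancelʳ-≡ (4 * m + 5 * n) _ _ (begin
    11 * n + (4 * m + 5 * n)     ≡⟨ rowᵇ m n ⟨
    4 * (m + 4 * n)              ≡⟨ cong (4 *_) e₂ ⟩
    4 * (m′ + 4 * n′)            ≡⟨ rowᵇ m′ n′ ⟩
    11 * n′ + (4 * m′ + 5 * n′)  ≡⟨ cong (11 * n′ +_) e₁ ⟨
    11 * n′ + (4 * m + 5 * n)    ∎))
  where
  open ≡-Reasoning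
  rowᵃ : ∀ i j → 4 * (4 * i + 5 * j) ≡ 11 * i + 5 * (i + 4 * j)
  rowᵃ = solve-∀
  rowᵇ : ∀ i j → 4 * (i + 4 * j) ≡ 11 * j + (4 * i + 5 * j)
  rowᵇ = solve-∀

ψ-h-injective : ∀ u v → ψ (h u) ≗ ψ (h v) → ψ u ≗ ψ v
ψ-h-injective u v eq = λ { a → proj₁ eqs ; b → proj₂ eqs }
  where
  ua×ub = ψ-h u
  va×vb = ψ-h v
  eqs = frequencyMatrix-injective (ψ u a) (ψ u b) (ψ v a) (ψ v b)
    (trans (sym (proj₁ ua×ub)) (trans (eq a) (proj₁ va×vb)))
    (trans (sym (proj₂ ua×ub)) (trans (eq b) (proj₂ va×vb)))

-- Cutting h q into pieces

-- Full images are left out: a cut at the end of an image is recorded as the empty residue.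
residues : List (List Letter)
residues = properPrefixes (image a) ++ properPrefixes (image b)

∈-residues : ∀ σ r {x s} → r ++ x ∷ s ≡ image σ → r ∈ residues
∈-residues a r eq = ∈-++⁺ˡ (subst (λ u → r ∈ properPrefixes u) eq (∈-properPrefixes r))
∈-residues b r eq = ∈-++⁺ʳ (properPrefixes (image a))
                           (subst (λ u → r ∈ properPrefixes u) eq (∈-properPrefixes r))

-- Whole images are peeled off while the cut lies at or beyond their end. A letter whose image is
-- cut stays in `q′`, so that `r ++ y` starts at an image boundary.
split : ∀ p y q → p ++ y ≡ h q →
        ∃ λ w → ∃₂ λ q′ r → q ≡ w ++ q′ × p ≡ h w ++ r × r ++ y ≡ h q′ × r ∈ residues
split []      y []      eq = [] , [] , [] , refl , refl , eq , here refl
split p       y (σ ∷ q) eq with ++-compare p (image σ) eq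
... | inj₂ (_ , _ , e , _)   = [] , σ ∷ q , p , refl , refl , eq , ∈-residues σ p e
... | inj₁ (p′ , refl , eq′) with split p′ y q eq′
...   | w , q′ , r , refl , refl , e , r∈ =
        σ ∷ w , q′ , r , refl , sym (++-assoc (image σ) (h w) r) , e , r∈

-- Each residue is put back in front of the next piece, and the cut at the end of that piece is then
-- found by `split`. The `n` pieces have `suc n` ends, one residue for each.
factorise : ∀ {n} (v : Fin n → List Letter) r y q → r ∈ residues →
  r ++ concat (tabulate v) ++ y ≡ h q →
  Σ[ w ∈ (Fin n → List Letter) ] Σ[ ρ ∈ (Fin (suc n) → List Letter) ]
    (concat (tabulate w) ≼ fin q × ρ zero ≡ r × (∀ i → ρ i ∈ residues) ×
     (∀ i → ρ (inject₁ i) ++ v i ≡ h (w i) ++ ρ (suc i)))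
factorise {zero}  v r y q r∈ eq = (λ ()) , (λ _ → r) , (q , refl) , refl , (λ _ → r∈) , λ ()
factorise {suc n} v r y q r∈ eq
  with split (r ++ v zero) (concat (tabulate (v ∘ suc)) ++ y) q
         (trans (++-assoc r (v zero) _)
                (trans (cong (r ++_) (sym (++-assoc (v zero) _ y))) eq))
... | w₀ , q′ , r′ , refl , e₀ , eq′ , r′∈
  with factorise (v ∘ suc) r′ y q′ r′∈ eq′
...   | w , ρ , (z , refl) , refl , ρ∈ , step =
        w₀ Vector.∷ w , r Vector.∷ ρ ,
        (z , ++-assoc w₀ (concat (tabulate w)) z) , refl ,
        (λ { zero → r∈ ; (suc i) → ρ∈ i }) ,
        (λ { zero → e₀ ; (suc i) → step i })

-- Arithmetic progressions modulo 11

-- Reducing the first term and the difference leaves finitely many progressions to inspect.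
%-progression : ∀ c d i m .{{_ : NonZero m}} → (c + i * d) % m ≡ (c % m + i * (d % m)) % m
%-progression c d i m = begin
  (c + i * d) % m
    ≡⟨ cong₂ (λ s t → (s + i * t) % m) (m≡m%n+[m/n]*n c m) (m≡m%n+[m/n]*n d m) ⟩
  (c % m + c / m * m + i * (d % m + d / m * m)) % m
    ≡⟨ cong (_% m) (rearrange (c % m) (c / m) (d % m) (d / m) i m) ⟩
  (c % m + i * (d % m) + (c / m + i * (d / m)) * m) % m
    ≡⟨ [m+kn]%n≡m%n _ (c / m + i * (d / m)) m ⟩
  (c % m + i * (d % m)) % m ∎
  where
  open ≡-Reasoning
  rearrange : ∀ c₀ c₁ d₀ d₁ i m →
    c₀ + c₁ * m + i * (d₀ + d₁ * m) ≡ c₀ + i * d₀ + (c₁ + i * d₁) * m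
  rearrange = solve-∀

%-step : ∀ c d i m .{{_ : NonZero m}} {c′} → c′ % m ≡ (c + d) % m →
         (c′ + i * d) % m ≡ (c + suc i * d) % m
%-step c d i m {c′} eq = begin
  (c′ + i * d) % m                    ≡⟨ %-progression c′ d i m ⟩
  (c′ % m + i * (d % m)) % m          ≡⟨ cong (λ t → (t + i * (d % m)) % m) eq ⟩
  ((c + d) % m + i * (d % m)) % m     ≡⟨ %-progression (c + d) d i m ⟨
  (c + d + i * d) % m                 ≡⟨ cong (_% m) (ℕ.+-assoc c d (i * d)) ⟩
  (c + suc i * d) % m                 ∎
  where open ≡-Reasoning

steps⇒progression : ∀ m .{{_ : NonZero m}} {n} d (c : Fin (suc n) → ℕ) →
  (∀ i → c (suc i) % m ≡ (c (inject₁ i) + d) % m) →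
  ∀ i → c i % m ≡ (c zero + toℕ i * d) % m
steps⇒progression m d c step zero = cong (_% m) (sym (+-identityʳ (c zero)))
steps⇒progression m {suc n} d c step (suc i) =
  trans (steps⇒progression m d (c ∘ suc) (step ∘ suc) i)
        (%-step (c zero) d (toℕ i) m (step zero))

class : List Letter → ℕ
class u = weight u % 11

-- The classes of the residues omit 5 and 8, whereas a progression of length 10
-- with non-zero difference omits only one class, 11 being prime.
progression-free : ∀ (g d : Fin 11) →
  (∀ (i : Fin 10) → (toℕ g + toℕ i * toℕ d) % 11 ∈ map class residues) → d ≡ zero
progression-free = from-yes (Fin.all? {n = 11} λ g → Fin.all? {n = 11} λ d →
  Fin.all? {n = 10} (λ i → (toℕ g + toℕ i * toℕ d) % 11 ∈? map class residues) →-dec (d Fin.≟ zero))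

toℕ-mod : ∀ m n .{{_ : NonZero n}} → toℕ (m mod n) ≡ m % n
toℕ-mod m n = Fin.toℕ-fromℕ< (m%n<n m n)

progression-constant : ∀ c d → (∀ (i : Fin 10) → (c + toℕ i * d) % 11 ∈ map class residues) →
                       d % 11 ≡ 0
progression-constant c d mem =
  trans (sym (toℕ-mod d 11)) (cong toℕ (progression-free (c mod 11) (d mod 11) λ i →
    subst (_∈ map class residues)
          (trans (%-progression c d (toℕ i) 11)
                 (sym (cong₂ (λ s t → (s + toℕ i * t) % 11) (toℕ-mod c 11) (toℕ-mod d 11))))
          (mem i)))

-- A finite check: the nine distinct residues take the classes 0, 1, 2, 3, 4, 6, 7, 9, 10, one each.
-- Prefixes common to both images are listed twice but are equal as words.
class-injective : ∀ {r s} → r ∈ residues → s ∈ residues → class r ≡ class s → r ≡ s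
class-injective r∈ s∈ = lookup (lookup distinct r∈) s∈
  where
  distinct : All (λ r → All (λ s → class r ≡ class s → r ≡ s) residues) residues
  distinct = from-yes (all? (λ r → all? (λ s →
    (class r ℕ.≟ class s) →-dec ≡-dec _≟_ r s) residues) residues)

-- Modulo 11 the factor `h (w i)` drops out of the cutting equation, so the class grows by the
-- common weight of the pieces from one residue to the next. Ten residues thus give a progression of
-- length 10 inside the allowed classes.
residues-constant : (v w : Fin 9 → List Letter) (ρ : Fin 10 → List Letter) →
  (∀ i j → ψ (v i) ≗ ψ (v j)) → (∀ i → ρ i ∈ residues) →
  (∀ i → ρ (inject₁ i) ++ v i ≡ h (w i) ++ ρ (suc i)) →
  ∀ i → ρ i ≡ ρ zero
residues-constant v w ρ v≗ ρ∈ step i = class-injective (ρ∈ i) (ρ∈ zero) (begin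
  class (ρ i)                                     ≡⟨ progression i ⟩
  (weight (ρ zero) + toℕ i * d) % 11              ≡⟨ %-progression (weight (ρ zero)) d (toℕ i) 11 ⟩
  (class (ρ zero) + toℕ i * (d % 11)) % 11        ≡⟨ cong (λ t → (class (ρ zero) + toℕ i * t) % 11) d%11≡0 ⟩
  (class (ρ zero) + toℕ i * (0 % 11)) % 11        ≡⟨ %-progression (weight (ρ zero)) 0 (toℕ i) 11 ⟨
  (weight (ρ zero) + toℕ i * 0) % 11              ≡⟨ cong (λ t → (weight (ρ zero) + t) % 11) (*-zeroʳ (toℕ i)) ⟩
  (weight (ρ zero) + 0) % 11                      ≡⟨ cong (_% 11) (+-identityʳ (weight (ρ zero))) ⟩
  class (ρ zero)                                  ∎)
  where
  open ≡-Reasoning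
  d = weight (v zero)

  class-step : ∀ i → class (ρ (suc i)) ≡ (weight (ρ (inject₁ i)) + d) % 11
  class-step i = begin
    class (ρ (suc i))                                  ≡⟨ [m+kn]%n≡m%n (weight (ρ (suc i))) k 11 ⟨
    (weight (ρ (suc i)) + k * 11) % 11                 ≡⟨ cong (_% 11) (ℕ.+-comm (weight (ρ (suc i))) _) ⟩
    (k * 11 + weight (ρ (suc i))) % 11                 ≡⟨ cong (λ t → (t + weight (ρ (suc i))) % 11) (weight-h (w i)) ⟨
    (weight (h (w i)) + weight (ρ (suc i))) % 11       ≡⟨ cong (_% 11) (weight-++ (h (w i)) _) ⟨
    class (h (w i) ++ ρ (suc i))                       ≡⟨ cong class (step i) ⟨
    class (ρ (inject₁ i) ++ v i)                       ≡⟨ cong (_% 11) (weight-++ (ρ (inject₁ i)) (v i)) ⟩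
    (weight (ρ (inject₁ i)) + weight (v i)) % 11       ≡⟨ cong₂ (λ s t → (weight (ρ (inject₁ i)) + (s + 7 * t)) % 11)
                                                            (v≗ i zero a) (v≗ i zero b) ⟩
    (weight (ρ (inject₁ i)) + d) % 11                  ∎
    where k = ψ (w i) a + 3 * ψ (w i) b

  progression : ∀ i → class (ρ i) ≡ (weight (ρ zero) + toℕ i * d) % 11
  progression = steps⇒progression 11 d (weight ∘ ρ) class-step

  d%11≡0 : d % 11 ≡ 0
  d%11≡0 = progression-constant (weight (ρ zero)) d λ i →
    subst (_∈ map class residues) (progression i) (∈-map⁺ class (ρ∈ i))

-- Abelian power freeness

ψ-conjugate : ∀ r u v → r ++ u ≡ v ++ r → ψ u ≗ ψ v
ψ-conjugate r u v eq σ = +-cancelʳ-≡ (ψ r σ) (ψ u σ) (ψ v σ) (begin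
  ψ u σ + ψ r σ  ≡⟨ ℕ.+-comm (ψ u σ) _ ⟩
  ψ r σ + ψ u σ  ≡⟨ ψ-++ r u σ ⟨
  ψ (r ++ u) σ   ≡⟨ cong (λ t → ψ t σ) eq ⟩
  ψ (v ++ r) σ   ≡⟨ ψ-++ v r σ ⟩
  ψ v σ + ψ r σ  ∎)
  where open ≡-Reasoning

h-powerFree : ∀ q → AbelianPowerFree 9 (fin q) → AbelianPowerFree 9 (fin (h q))
h-powerFree q free x v (y , eq) v≗
  -- The end of `x` is the first of the ten cuts; its residue `r` starts the factorisation.
  with split x (concat (tabulate v) ++ y) q (trans (sym (++-assoc x _ y)) eq)
... | x′ , q′ , r , refl , _ , eq′ , r∈
  with factorise v r y q′ r∈ eq′
...   | w , ρ , (z , refl) , _ , ρ∈ , step = v≡[]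
  where
  ρ-constant = residues-constant v w ρ v≗ ρ∈ step

  conjugate : ∀ i → ρ zero ++ v i ≡ h (w i) ++ ρ zero
  conjugate i = subst (λ r → r ++ v i ≡ h (w i) ++ ρ zero) (ρ-constant (inject₁ i))
    (subst (λ r → ρ (inject₁ i) ++ v i ≡ h (w i) ++ r) (ρ-constant (suc i)) (step i))

  ψ-v≗ψ-hw : ∀ i → ψ (v i) ≗ ψ (h (w i))
  ψ-v≗ψ-hw i = ψ-conjugate (ρ zero) (v i) (h (w i)) (conjugate i)

  w≗ : ∀ i j → ψ (w i) ≗ ψ (w j)
  w≗ i j = ψ-h-injective (w i) (w j) λ σ →
    trans (sym (ψ-v≗ψ-hw i σ)) (trans (v≗ i j σ) (ψ-v≗ψ-hw j σ))

  w≡[] : ∀ i → w i ≡ []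
  w≡[] = free x′ w (z , ++-assoc x′ _ z) w≗

  v≡[] : ∀ i → v i ≡ []
  v≡[] i = ψ≗ψ[]⇒≡[] (v i) λ σ →
    trans (ψ-v≗ψ-hw i σ) (cong (λ u → ψ (h u) σ) (w≡[] i))

-- An abelian 9-power in `w` ends within a finite prefix, which lies in `h q` for a finite prefix
-- `q` of `u`; so infinite words reduce to `h-powerFree`.
h-powerFreeMorphism : AbelianPowerFreeMorphism 9 h
h-powerFreeMorphism = h-isMorphism , λ u w image free x v p≼w →
  let q , q≼u , p≼hq = Equivalence.to (image _) p≼w
  in  h-powerFree q (powerFree-prefix {w = u} q≼u free) x v p≼hq

factor-of-letter : ∀ x u v {y z : List Letter} → (x ++ u ++ v ++ y) ++ z ≡ a ∷ [] → u ≡ [] ⊎ v ≡ []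
factor-of-letter x             []          v       eq = inj₁ refl
factor-of-letter x             (_ ∷ _)     []      eq = inj₂ refl
factor-of-letter []            (_ ∷ [])    (_ ∷ _) ()
factor-of-letter []            (_ ∷ _ ∷ _) (_ ∷ _) ()
factor-of-letter (_ ∷ [])      (_ ∷ _)     (_ ∷ _) ()
factor-of-letter (_ ∷ _ ∷ _)   (_ ∷ _)     (_ ∷ _) ()

-- A single letter has no room for two non-empty pieces, and one empty piece forces all to be empty.
letter-powerFree : AbelianPowerFree 9 (fin (a ∷ []))
letter-powerFree x v (y , eq) v≗ i
  with factor-of-letter x (v zero) (v (suc zero)) eq
... | inj₁ e = ψ≗ψ[]⇒≡[] (v i) λ σ → trans (v≗ i zero σ) (cong (λ u → ψ u σ) e)
... | inj₂ e = ψ≗ψ[]⇒≡[] (v i) λ σ → trans (v≗ i (suc zero) σ) (cong (λ u → ψ u σ) e)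

-- The fixed point

h^ : ℕ → List Letter
h^ zero    = a ∷ []
h^ (suc k) = h (h^ k)

h^-powerFree : ∀ k → AbelianPowerFree 9 (fin (h^ k))
h^-powerFree zero    = letter-powerFree
h^-powerFree (suc k) = h-powerFree (h^ k) (h^-powerFree k)

h-∷ : ∀ σ u → ∃₂ λ τ v → h (σ ∷ u) ≡ τ ∷ v
h-∷ a u = a , _ , refl
h-∷ b u = a , _ , refl

-- The image of `a` properly extends `a`, and applying `h` preserves this: since no image is empty,
-- the extension stays proper.
h^-step : ∀ k → ∃₂ λ σ u → h^ k ++ σ ∷ u ≡ h^ (suc k)
h^-step zero    = a , b ∷ a ∷ a ∷ [] , refl
h^-step (suc k) =
  let σ , u , eq = h^-step k
      τ , v , e  = h-∷ σ u
  in  τ , v , trans (cong (h^ (suc k) ++_) (sym e)) (trans (sym (h-++ (h^ k) (σ ∷ u))) (cong h eq))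

h^-mono : ∀ {j k} → j ≤ k → h^ j ≼ fin (h^ k)
h^-mono {j} j≤k = go (ℕ.≤⇒≤′ j≤k)
  where
  go : ∀ {k} → j ≤′ k → h^ j ≼ fin (h^ k)
  go ≤′-refl           = [] , ++-identityʳ (h^ j)
  go (≤′-step {k} j≤k) =
    let σ , u , eq = h^-step k
    in  ≼-trans (fin (h^ (suc k))) (go j≤k) (σ ∷ u , eq)

n<length-h^ : ∀ k → k < length (h^ k)
n<length-h^ zero    = s≤s z≤n
n<length-h^ (suc k) = let σ , u , eq = h^-step k in begin-strict
  suc k                             <⟨ s≤s (n<length-h^ k) ⟩
  suc (length (h^ k))               ≤⟨ s≤s (m≤m+n _ (length u)) ⟩
  suc (length (h^ k) + length u)    ≡⟨ ℕ.+-suc (length (h^ k)) _ ⟨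
  length (h^ k) + length (σ ∷ u)    ≡⟨ length-++ (h^ k) ⟨
  length (h^ k ++ σ ∷ u)            ≡⟨ cong length eq ⟩
  length (h^ (suc k))               ∎
  where open ℕ.≤-Reasoning

-- The value beyond the end of the word is junk.
at : List Letter → ℕ → Letter
at []      _       = a
at (x ∷ _) zero    = x
at (_ ∷ u) (suc n) = at u n

at-++ : ∀ p y {i} → i < length p → at (p ++ y) i ≡ at p i
at-++ (_ ∷ p) y {zero}  _         = refl
at-++ (_ ∷ p) y {suc i} (s≤s i<p) = at-++ p y i<p

at-≼ : ∀ {p q i} → p ≼ fin q → i < length p → at q i ≡ at p i
at-≼ {p} (y , refl) = at-++ p y

applyUpTo-at : ∀ (f : ℕ → Letter) p → (∀ {i} → i < length p → f i ≡ at p i) →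
               applyUpTo f (length p) ≡ p
applyUpTo-at f []      eq = refl
applyUpTo-at f (x ∷ p) eq = cong₂ _∷_ (eq (s≤s z≤n)) (applyUpTo-at (f ∘ suc) p (eq ∘ s≤s))

-- The `n`-th iterate is long enough to have a letter at position `n`, and all longer iterates agree
-- with it there.
h^∞ : ℕ → Letter
h^∞ n = at (h^ n) n

h^-≼ : ∀ k → h^ k ≼ inf h^∞
h^-≼ k = applyUpTo-at h^∞ (h^ k) agree
  where
  agree : ∀ {i} → i < length (h^ k) → at (h^ i) i ≡ at (h^ k) i
  agree {i} i< with ≤-total i k
  ... | inj₁ i≤k = sym (at-≼ (h^-mono i≤k) (n<length-h^ i))
  ... | inj₂ k≤i = at-≼ (h^-mono k≤i) i<

≼-h^ : ∀ p → p ≼ inf h^∞ → ∃ λ k → p ≼ fin (h^ k)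
≼-h^ p p≼ = length p , ≼-inf-comparable h^∞ p _ p≼ (h^-≼ (length p)) (ℕ.<⇒≤ (n<length-h^ (length p)))

h-mono : ∀ {p q} → p ≼ fin q → h p ≼ fin (h q)
h-mono {p} (y , refl) = h y , sym (h-++ p y)

-- Both directions compare with iterates: a prefix of `h^ k` is one of `h (h^ k)`, and if `q` is a
-- prefix of `h^ k`, then `h q` is one of `h^ (suc k)`.
h^∞-fixed : IsFixedPoint h h^∞
h^∞-fixed p = mk⇔ to from
  where
  to : p ≼ inf h^∞ → ∃ λ q → q ≼ inf h^∞ × p ≼ fin (h q)
  to p≼ =
    let k , p≼h^k = ≼-h^ p p≼
        σ , u , e = h^-step k
    in  h^ k , h^-≼ k , ≼-trans (fin (h^ (suc k))) p≼h^k (σ ∷ u , e)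

  from : (∃ λ q → q ≼ inf h^∞ × p ≼ fin (h q)) → p ≼ inf h^∞
  from (q , q≼ , p≼hq) =
    let k , q≼h^k = ≼-h^ q q≼
    in  ≼-trans (inf h^∞) (≼-trans (fin (h^ (suc k))) p≼hq (h-mono q≼h^k)) (h^-≼ (suc k))

h^∞-powerFree : AbelianPowerFree 9 (inf h^∞)
h^∞-powerFree x v p≼ = let k , p≼h^k = ≼-h^ _ p≼ in h^-powerFree k x v p≼h^k

-- Excluded factors

-- An automaton counting the a's since the last b, dead once aaaaa or bb is read.
data State : Set where
  a⁰ a¹ a² a³ a⁴ dead : State

δ : State → Letter → State
δ a⁰   a = a¹
δ a¹   a = a²
δ a²   a = a³
δ a³   a = a⁴
δ a⁴   a = dead
δ a⁰   b = dead
δ dead _ = dead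
δ _    b = a⁰

run : State → List Letter → State
run = foldl δ

run-dead : ∀ u → run dead u ≡ dead
run-dead []      = refl
run-dead (_ ∷ u) = run-dead u

-- At image boundaries only `a⁰` and `a²` occur: from either state the image of `a` leads to `a²`
-- and that of `b` to `a⁰`, never passing through `dead`.
run-h-a⁰ : ∀ q → run a⁰ (h q) ≢ dead
run-h-a² : ∀ q → run a² (h q) ≢ dead
run-h-a⁰ []      = λ ()
run-h-a⁰ (a ∷ q) = run-h-a² q
run-h-a⁰ (b ∷ q) = run-h-a⁰ q
run-h-a² []      = λ ()
run-h-a² (a ∷ q) = run-h-a² q
run-h-a² (b ∷ q) = run-h-a⁰ q

-- By the fixed point property an occurrence of `u` would lie in some `h q`. What `x` leads to is
-- unknown, so `u` has to kill every state; `dead` then persists to the end of `h q`.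
deadly-not-factor : ∀ u → (∀ s → run s u ≡ dead) → ¬ IsFactor u (inf h^∞)
deadly-not-factor u kills (x , xu≼) =
  let q , _ , y , eq = Equivalence.to (h^∞-fixed (x ++ u)) xu≼
  in  run-h-a⁰ q (begin
    run a⁰ (h q)                 ≡⟨ cong (run a⁰) eq ⟨
    run a⁰ ((x ++ u) ++ y)       ≡⟨ foldl-++ δ a⁰ (x ++ u) y ⟩
    run (run a⁰ (x ++ u)) y      ≡⟨ cong (λ s → run s y) (foldl-++ δ a⁰ x u) ⟩
    run (run (run a⁰ x) u) y     ≡⟨ cong (λ s → run s y) (kills (run a⁰ x)) ⟩
    run dead y                   ≡⟨ run-dead y ⟩
    dead                         ∎)
  where open ≡-Reasoning

aaaaa-deadly : ∀ s → run s (a ∷ a ∷ a ∷ a ∷ a ∷ []) ≡ dead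
aaaaa-deadly = λ { a⁰ → refl ; a¹ → refl ; a² → refl ; a³ → refl ; a⁴ → refl ; dead → refl }

bb-deadly : ∀ s → run s (b ∷ b ∷ []) ≡ dead
bb-deadly = λ { a⁰ → refl ; a¹ → refl ; a² → refl ; a³ → refl ; a⁴ → refl ; dead → refl }

theorem2p21 : Σ[ h ∈ (List Letter → List Letter) ] Σ[ Ω ∈ (ℕ → Letter) ]
    (AbelianPowerFreeMorphism 9 h
    × IsFixedPoint h Ω
    × ¬ IsFactor (a ∷ a ∷ a ∷ a ∷ a ∷ []) (inf Ω)
    × ¬ IsFactor (b ∷ b ∷ []) (inf Ω)
    × AbelianPowerFree 9 (inf Ω))
theorem2p21 =
  h , h^∞ , h-powerFreeMorphism , h^∞-fixed ,
  deadly-not-factor _ aaaaa-deadly , deadly-not-factor _ bb-deadly , h^∞-powerFree
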